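{- Let $G$ be a graph on $n$ vertices, and let $\mathcal{T}_1=(B_1,l_1)$ and $\mathcal{T}_2=(B_2,l_2)$ be two labelled spanning trees of $G$. Then $\mathcal{T}_1$ can be reconfigured to $\mathcal{T}_2$ by a sequence of (labelled) basis exchange steps if and only if for each label $i\in\{1,\ldots,n-1\}$, the edge $l_1^{ -1}(i)$ and the edge $l_2^{ -1}(i)$ lie in the same 2-connected component (block) of $G$. Moreover, when reconfiguration is possible, it can be accomplished with $O(n^2)$ basis exchange steps.
   Context: A labelled spanning tree of an $n$-vertex graph $G$ is a pair $(B,l)$ where $B$ is the edge set of a spanning tree of $G$ and $l:B\to\{1,\ldots,n-1\}$ is a bijection assigning a unique label to each edge. A basis exchange step on $(B,l)$ removes an edge $e\in B$ and adds an edge $e'\notin B$ such that $(B\setminus\{e\})\cup\{e'\}$ is again a spanning tree; the new edge $e'$ receives the label $l(e)$, and all other labels are unchanged. Two labelled spanning trees are equal if they have the same edges with the same labels. The 2-connected components (blocks) of $G$ partition the edges: two distinct edges are in the same block iff some cycle of $G$ contains both. -}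

module Defs where

open import Data.Nat using (ℕ; zero; suc; _∸_; _≤_)
open import Data.Fin using (Fin; zero; suc; inject₁; fromℕ)
open import Data.Product using (Σ; ∃; _×_; _,_; proj₁; proj₂; swap)
open import Data.Sum using (_⊎_)
open import Relation.Binary.PropositionalEquality using (_≡_; _≢_)
open import Relation.Nullary using (¬_)
open import Function.Definitions using (Injective)

-- A (finite) multigraph presentation: vertices Fin n, edges Fin m,
-- each edge e has endpoints  ends e .
Ends : ℕ → ℕ → Set
Ends n m = Fin m → Fin n × Fin n

Joins : ∀ {n m} → Ends n m → Fin m → Fin n → Fin n → Set
Joins ends e x y = (ends e ≡ (x , y)) ⊎ (ends e ≡ (y , x))

Simple : ∀ {n m} → Ends n m → Set
Simple ends =
  (∀ e → proj₁ (ends e) ≢ proj₂ (ends e)) ×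
  (∀ e f → (ends e ≡ ends f) ⊎ (ends e ≡ swap (ends f)) → e ≡ f)

record Cycle {n m : ℕ} (ends : Ends n m) : Set where
  field
    len      : ℕ
    len≥1    : 1 ≤ len
    vtx      : Fin (suc len) → Fin n
    edg      : Fin len → Fin m
    closed   : vtx (fromℕ len) ≡ vtx zero
    vtx-inj  : ∀ i j → vtx (inject₁ i) ≡ vtx (inject₁ j) → i ≡ j
    edg-inj  : Injective _≡_ _≡_ edg
    edg-join : ∀ i → Joins ends (edg i) (vtx (inject₁ i)) (vtx (suc i))

OnCycle : ∀ {n m} {ends : Ends n m} → Fin m → Cycle ends → Set
OnCycle e C = ∃ λ i → Cycle.edg C i ≡ e

SameBlock : ∀ {n m} → Ends n m → Fin m → Fin m → Set
SameBlock ends e f = (e ≡ f) ⊎ (Σ (Cycle ends) λ C → OnCycle e C × OnCycle f C)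

data Walk {n m : ℕ} (ends : Ends n m) (B : Fin m → Set) : Fin n → Fin n → Set where
  here : ∀ {x} → Walk ends B x x
  step : ∀ {x y z} (e : Fin m) → B e → Joins ends e x y → Walk ends B y z → Walk ends B x z

IsSpanningTree : ∀ {n m} → Ends n m → (Fin m → Set) → Set
IsSpanningTree {n} ends B =
  (∀ (x y : Fin n) → Walk ends B x y) ×
  ¬ (Σ (Cycle ends) λ C → ∀ i → B (Cycle.edg C i))

-- A labelled spanning tree (B , l), recorded via the inverse labelling
-- lab = l⁻¹ : labels → edges, which is injective with image B.
-- Labels {1,…,n-1} are represented by Fin (n ∸ 1) (label i+1 ↦ i).
record LST {n m : ℕ} (ends : Ends n m) : Set where
  field
    lab     : Fin (n ∸ 1) → Fin m
    lab-inj : Injective _≡_ _≡_ lab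
    tree    : IsSpanningTree ends (λ e → ∃ λ i → lab i ≡ e)

open LST public

InTree : ∀ {n m} {ends : Ends n m} → LST ends → Fin m → Set
InTree T e = ∃ λ i → lab T i ≡ e

_≈T_ : ∀ {n m} {ends : Ends n m} → LST ends → LST ends → Set
T ≈T T' = ∀ i → lab T i ≡ lab T' i

-- one labelled basis exchange step: the edge with label j is removed,
-- an edge e' ∉ B is added and gets label j, other labels unchanged
-- (T' being a labelled spanning tree means the result is a spanning tree).
ExchangeStep : ∀ {n m} {ends : Ends n m} → LST ends → LST ends → Set
ExchangeStep {n} T T' =
  Σ (Fin (n ∸ 1)) λ j →
    (∀ i → i ≢ j → lab T' i ≡ lab T i) × (¬ InTree T (lab T' j))

data Steps {n m : ℕ} {ends : Ends n m} : ℕ → LST ends → LST ends → Set where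
  done : ∀ {T T'} → T ≈T T' → Steps zero T T'
  more : ∀ {k T T' T''} → ExchangeStep T T' → Steps k T' T'' → Steps (suc k) T T''

Reconfigurable : ∀ {n m} {ends : Ends n m} → LST ends → LST ends → Set
Reconfigurable T T' = ∃ λ k → Steps k T T'

{-# OPTIONS --safe #-}

-- Replacing e by x in a spanning tree forces e onto the cycle that x closes, so an
-- exchange keeps every label in its block; being in a common block is transitive
-- because a cycle can be rerouted through an ear of a cycle meeting it in two vertices.
-- Conversely, any acyclic edge set S can be absorbed into a tree by at most |S|
-- exchanges that do not touch the edges of S already present. Absorbing the target's
-- edges leaves only a permutation of labels inside blocks. To swap the labels of e and
-- f, take a cycle through both and a third edge g of it, absorb the cycle minus g,
-- swap the labels in three exchanges through g, and undo the absorption: O(n) steps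
-- for each of at most n - 1 swaps.
module Submission where

open import Defs
open import Data.Nat using (ℕ; zero; suc; _∸_; _+_; _*_; _≤_; z≤n; s≤s)
open import Data.Nat.Properties using (≤-trans; ≤-refl; ≤-reflexive; +-mono-≤; m≤n⇒m≤1+n; m≤m+n; m≤n+m)
open import Data.Nat.Tactic.RingSolver using (solve-∀)
open import Data.Fin using (Fin; zero; suc; inject₁; fromℕ; _≟_)
open import Data.List using (List; []; _∷_; _++_; [_]; length; lookup; tabulate; allFin)
open import Data.List.Properties using (++-assoc; length-tabulate)
open import Data.List.Membership.Propositional using (_∈_; _∉_; lose; find)
open import Data.List.Membership.Propositional.Properties using (∈-++⁺ˡ; ∈-++⁺ʳ; ∈-++⁻; ∈-lookup; ∈-tabulate⁺; ∈-tabulate⁻; ∈-allFin)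
open import Data.List.Relation.Unary.Any using (any?; here; there; index)
open import Data.List.Relation.Unary.Any.Properties using (lookup-index)
open import Data.List.Relation.Unary.All using ([]; _∷_)
open import Data.List.Relation.Unary.All.Properties using (¬Any⇒All¬; All¬⇒¬Any)
open import Data.List.Relation.Unary.AllPairs using ([]; _∷_)
open import Data.List.Relation.Unary.Unique.Propositional using (Unique)
import Data.List.Relation.Unary.Unique.Propositional.Properties as Uniqueₚ
open import Data.List.Relation.Binary.Permutation.Propositional using (_↭_; ↭⇒↭ₛ; ↭-refl; ↭-sym; ↭-trans; ↭-reflexive; prep)
open import Data.List.Relation.Binary.Permutation.Propositional.Properties using (∈-resp-↭; shift; shifts; ++⁺; ++⁺ʳ; ++-comm; drop-∷; ∷↭∷ʳ)
import Data.List.Relation.Binary.Permutation.Setoid.Properties as Permₛ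
import Data.Fin.Permutation as Perm
open import Data.Fin.Permutation using (Permutation′; _⟨$⟩ʳ_; _⟨$⟩ˡ_; inverseˡ; inverseʳ)
import Data.Fin.Properties as Finₚ
open import Data.Fin.Properties using (injective⇒≤)
open import Data.Vec.Functional using (updateAt)
open import Data.Vec.Functional.Properties using (updateAt-updates; updateAt-minimal)
open import Data.Product using (Σ; ∃; _×_; _,_; proj₁; proj₂; map₂)
open import Data.Product.Properties using (,-injective)
open import Data.Sum using (_⊎_; inj₁; inj₂; swap)
open import Data.Unit using (⊤; tt)
open import Function using (id; _∘_)
open import Relation.Binary.PropositionalEquality using (_≡_; _≢_; ≢-sym; refl; sym; trans; cong; subst; setoid)
open import Relation.Nullary.Decidable using (dec-true; dec-false; decidable-stable)
open import Relation.Nullary using (¬_; ¬?; Dec; yes; no; contradiction)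

-- Lists without repetition.

module _ {A : Set} where
  Unique-∷ : ∀ {x : A} {xs} → x ∉ xs → Unique xs → Unique (x ∷ xs)
  Unique-∷ x∉ u = ¬Any⇒All¬ _ x∉ ∷ u

  Unique-head : ∀ {x : A} {xs} → Unique (x ∷ xs) → x ∉ xs
  Unique-head (px ∷ _) = All¬⇒¬Any px

  Unique-tail : ∀ {x : A} {xs} → Unique (x ∷ xs) → Unique xs
  Unique-tail (_ ∷ u) = u

  Unique-↭ : ∀ {xs ys : List A} → xs ↭ ys → Unique xs → Unique ys
  Unique-↭ p = Permₛ.Unique-resp-↭ (setoid A) (↭⇒↭ₛ p)

  Unique-disjoint : ∀ (xs : List A) {ys v} → Unique (xs ++ ys) → v ∈ xs → v ∉ ys
  Unique-disjoint (x ∷ xs) u (here refl) q = Unique-head u (∈-++⁺ʳ xs q)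
  Unique-disjoint (x ∷ xs) u (there p)   q = Unique-disjoint xs (Unique-tail u) p q

  Unique-++ˡ : ∀ (xs : List A) {ys} → Unique (xs ++ ys) → Unique xs
  Unique-++ˡ []       u = []
  Unique-++ˡ (x ∷ xs) u =
    Unique-∷ (Unique-head u ∘ ∈-++⁺ˡ) (Unique-++ˡ xs (Unique-tail u))

  Unique-++ʳ : ∀ (xs : List A) {ys} → Unique (xs ++ ys) → Unique ys
  Unique-++ʳ []       u = u
  Unique-++ʳ (x ∷ xs) u = Unique-++ʳ xs (Unique-tail u)

  Unique-lookup : ∀ {xs : List A} → Unique xs → ∀ i j → lookup xs i ≡ lookup xs j → i ≡ j
  Unique-lookup {x ∷ xs} u zero    zero    _  = refl
  Unique-lookup {x ∷ xs} u zero    (suc j) eq = contradiction (subst (_∈ xs) (sym eq) (∈-lookup j)) (Unique-head u)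
  Unique-lookup {x ∷ xs} u (suc i) zero    eq = contradiction (subst (_∈ xs) eq (∈-lookup i)) (Unique-head u)
  Unique-lookup {x ∷ xs} u (suc i) (suc j) eq = cong suc (Unique-lookup (Unique-tail u) i j eq)

_∈?_ : ∀ {k} (x : Fin k) (xs : List (Fin k)) → Dec (x ∈ xs)
x ∈? xs = any? (x ≟_) xs

-- Walks, paths and their vertex and edge lists.

module Walks {n m : ℕ} (ends : Ends n m) where

  J : Fin m → Fin n → Fin n → Set
  J = Joins ends

  W : (Fin m → Set) → Fin n → Fin n → Set
  W = Walk ends

  J-ends : ∀ {e a b c d} → J e a b → J e c d → (a ≡ c × b ≡ d) ⊎ (a ≡ d × b ≡ c)
  J-ends (inj₁ p) (inj₁ q) = inj₁ (,-injective (trans (sym p) q))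
  J-ends (inj₁ p) (inj₂ q) with refl , refl ← ,-injective (trans (sym p) q) = inj₂ (refl , refl)
  J-ends (inj₂ p) (inj₁ q) with refl , refl ← ,-injective (trans (sym p) q) = inj₂ (refl , refl)
  J-ends (inj₂ p) (inj₂ q) with refl , refl ← ,-injective (trans (sym p) q) = inj₁ (refl , refl)

  -- A closed walk is encoded as a cycle by having a repetition-free iv, which omits the final vertex.
  iv tv : ∀ {B x y} → W B x y → List (Fin n)
  iv here                   = []
  iv (step {x} e b j w)     = x ∷ iv w
  tv here                   = []
  tv (step {y = y} e b j w) = y ∷ tv w

  verts : ∀ {B x y} → W B x y → List (Fin n)
  verts {y = y} w = iv w ++ [ y ]

  es : ∀ {B x y} → W B x y → List (Fin m)
  es here           = []
  es (step e b j w) = e ∷ es w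

  infixr 5 _∙_
  _∙_ : ∀ {B x y z} → W B x y → W B y z → W B x z
  here         ∙ v = v
  step e b j w ∙ v = step e b j (w ∙ v)

  iv-∙ : ∀ {B x y z} (u : W B x y) (v : W B y z) → iv (u ∙ v) ≡ iv u ++ iv v
  iv-∙ here           v = refl
  iv-∙ (step e b j u) v = cong (_ ∷_) (iv-∙ u v)

  tv-∙ : ∀ {B x y z} (u : W B x y) (v : W B y z) → tv (u ∙ v) ≡ tv u ++ tv v
  tv-∙ here           v = refl
  tv-∙ (step e b j u) v = cong (_ ∷_) (tv-∙ u v)

  es-∙ : ∀ {B x y z} (u : W B x y) (v : W B y z) → es (u ∙ v) ≡ es u ++ es v
  es-∙ here           v = refl
  es-∙ (step e b j u) v = cong (e ∷_) (es-∙ u v)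

  rev : ∀ {B x y} → W B x y → W B y x
  rev here           = here
  rev (step e b j w) = rev w ∙ step e b (swap j) here

  es-rev : ∀ {B x y} (w : W B x y) → es (rev w) ↭ es w
  es-rev here           = ↭-refl
  es-rev (step e b j w) = ↭-trans (↭-reflexive (es-∙ (rev w) _))
    (↭-trans (++⁺ʳ [ e ] (es-rev w)) (++-comm (es w) [ e ]))

  iv-rev : ∀ {B x y} (w : W B x y) → iv (rev w) ↭ tv w
  iv-rev here                   = ↭-refl
  iv-rev (step {y = y} e b j w) = ↭-trans (↭-reflexive (iv-∙ (rev w) _))
    (↭-trans (++⁺ʳ [ y ] (iv-rev w)) (++-comm (tv w) [ y ]))

  verts-tv : ∀ {B x y} (w : W B x y) → verts w ≡ x ∷ tv w
  verts-tv here           = refl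
  verts-tv (step e b j w) = cong (_ ∷_) (verts-tv w)

  -- For a closed walk `x ∷ tv w` and `iv w ++ [ x ]` are the same list `verts w`; cancelling `x`
  -- leaves the permutation.
  tv↭iv : ∀ {B x} (w : W B x x) → tv w ↭ iv w
  tv↭iv {x = x} w = drop-∷ (↭-trans (↭-reflexive (sym (verts-tv w))) (↭-sym (∷↭∷ʳ x (iv w))))

  es-all : ∀ {B x y} (w : W B x y) {e} → e ∈ es w → B e
  es-all (step e b j w) (here refl) = b
  es-all (step e b j w) (there p)   = es-all w p

  -- The edge set is a type index, so moving a walk to another set rebuilds it. Asking for `B` only
  -- on `es w` allows sets that merely contain the edges used.
  retype : ∀ {A B : Fin m → Set} {x y} (w : W A x y) → (∀ e → e ∈ es w → B e) → W B x y
  retype here           f = here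
  retype (step e b j w) f = step e (f e (here refl)) j (retype w (λ e p → f e (there p)))

  iv-retype : ∀ {A B : Fin m → Set} {x y} (w : W A x y) (f : ∀ e → e ∈ es w → B e) → iv (retype {B = B} w f) ≡ iv w
  iv-retype here           f = refl
  iv-retype (step e b j w) f = cong (_ ∷_) (iv-retype w (λ e p → f e (there p)))

  es-retype : ∀ {A B : Fin m → Set} {x y} (w : W A x y) (f : ∀ e → e ∈ es w → B e) → es (retype {B = B} w f) ≡ es w
  es-retype here           f = refl
  es-retype (step e b j w) f = cong (e ∷_) (es-retype w (λ e p → f e (there p)))

  mapW : ∀ {A B x y} → (∀ {e} → A e → B e) → W A x y → W B x y
  mapW f w = retype w (λ _ p → f (es-all w p))

  start∈ : ∀ {B x y} (w : W B x y) → x ∈ verts w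
  start∈ here           = here refl
  start∈ (step e b j w) = here refl

  end∈verts : ∀ {B x y} (w : W B x y) {e a b} → e ∈ es w → J e a b → a ∈ verts w
  end∈verts (step e b j w) (here refl) j' with J-ends j j'
  ... | inj₁ (refl , _) = here refl
  ... | inj₂ (_ , refl) = there (start∈ w)
  end∈verts (step e b j w) (there p) j' = there (end∈verts w p j')

  source∈iv : ∀ {B x y} (w : W B x y) {e} → e ∈ es w → ∃ λ a → ∃ λ b → J e a b × a ∈ iv w
  source∈iv (step e b j w) (here refl) = _ , _ , j , here refl
  source∈iv (step e b j w) (there p) with a , b' , j' , q ← source∈iv w p = a , b' , j' , there q

  target∈tv : ∀ {B x y} (w : W B x y) {e} → e ∈ es w → ∃ λ a → ∃ λ b → J e a b × b ∈ tv w
  target∈tv (step e b j w) (here refl) = _ , _ , j , here refl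
  target∈tv (step e b j w) (there p) with a , b' , j' , q ← target∈tv w p = a , b' , j' , there q

  -- If the first edge recurred later, its starting vertex would be visited again.
  path-edges : ∀ {B x y} (w : W B x y) → Unique (verts w) → Unique (es w)
  path-edges here           u = []
  path-edges (step e b j w) u =
    Unique-∷ (λ p → Unique-head u (end∈verts w p j)) (path-edges w (Unique-tail u))

  suffix : ∀ {B x y v} (w : W B x y) → Unique (verts w) → v ∈ verts w →
           Σ (W B v y) λ w' → Unique (verts w')
  suffix here           u (here refl) = here , u
  suffix (step e b j w) u (here refl) = step e b j w , u
  suffix (step e b j w) u (there p)   = suffix w (Unique-tail u) p

  -- When the path found for the rest already visits the start, its suffix from that visit is taken
  -- instead.
  walk⇒path : ∀ {B x y} → W B x y → Σ (W B x y) λ w → Unique (verts w)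
  walk⇒path here = here , Unique-∷ (λ ()) []
  walk⇒path (step {x} e b j w) with walk⇒path w
  ... | w' , u with x ∈? verts w'
  ... | yes p = suffix w' u p
  ... | no ¬p = step e b j w' , Unique-∷ ¬p u

  split-vertex : ∀ {B x y v} (w : W B x y) → v ∈ iv w →
    Σ (W B x v) λ p → Σ (W B v y) λ q → w ≡ p ∙ q
  split-vertex (step e b j w) (here refl) = here , step e b j w , refl
  split-vertex (step e b j w) (there p) with u , q , refl ← split-vertex w p = step e b j u , q , refl

  split-edge : ∀ {B x y e} (w : W B x y) → e ∈ es w →
    ∃ λ a → ∃ λ b → J e a b × B e × Σ (W B x a) λ p → Σ (W B b y) λ q →
      (iv w ≡ iv p ++ a ∷ iv q) × (es w ≡ es p ++ e ∷ es q)
  split-edge (step e b j w) (here refl) = _ , _ , j , b , here , w , refl , refl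
  split-edge (step e b j w) (there r) with a , b' , j' , Be , p , q , eq₁ , eq₂ ← split-edge w r =
    a , b' , j' , Be , step e b j p , q , cong (_ ∷_) eq₁ , cong (e ∷_) eq₂

  -- Cut the walk before its first and after its last use of the edge f.
  cross : ∀ {A C f u v a b} → J f u v → (∀ {e} → C e → A e ⊎ e ≡ f) → W C a b →
          W A a b ⊎ (W A a u × W A v b ⊎ W A a v × W A u b)
  cross j h here = inj₁ here
  cross j h (step e c j' w) with h c | cross j h w
  ... | inj₁ a    | inj₁ p              = inj₁ (step e a j' p)
  ... | inj₁ a    | inj₂ (inj₁ (p , q)) = inj₂ (inj₁ (step e a j' p , q))
  ... | inj₁ a    | inj₂ (inj₂ (p , q)) = inj₂ (inj₂ (step e a j' p , q))
  ... | inj₂ refl | r with J-ends j j'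
  ... | inj₁ (refl , refl) with r
  ...   | inj₁ p              = inj₂ (inj₁ (here , p))
  ...   | inj₂ (inj₁ (p , q)) = inj₂ (inj₁ (here , q))
  ...   | inj₂ (inj₂ (p , q)) = inj₁ q
  cross j h (step e c j' w) | inj₂ refl | r | inj₂ (refl , refl) with r
  ...   | inj₁ p              = inj₂ (inj₂ (here , p))
  ...   | inj₂ (inj₁ (p , q)) = inj₁ q
  ...   | inj₂ (inj₂ (p , q)) = inj₂ (inj₂ (here , q))

  -- Translation between closed walks and cycles.

  vt : ∀ {B x y} (w : W B x y) → Fin (suc (length (es w))) → Fin n
  vt {x = x} w          zero    = x
  vt (step e b j w) (suc i) = vt w i

  vt-last : ∀ {B x y} (w : W B x y) → vt w (fromℕ _) ≡ y
  vt-last here           = refl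
  vt-last (step e b j w) = vt-last w

  vt∈iv : ∀ {B x y} (w : W B x y) i → vt w (inject₁ i) ∈ iv w
  vt∈iv (step e b j w) zero    = here refl
  vt∈iv (step e b j w) (suc i) = there (vt∈iv w i)

  vt-injective : ∀ {B x y} (w : W B x y) → Unique (iv w) →
                 ∀ i j → vt w (inject₁ i) ≡ vt w (inject₁ j) → i ≡ j
  vt-injective (step e b j w) u zero    zero    _  = refl
  vt-injective (step e b j w) u zero    (suc l) eq = contradiction (subst (_∈ iv w) (sym eq) (vt∈iv w l)) (Unique-head u)
  vt-injective (step e b j w) u (suc k) zero    eq = contradiction (subst (_∈ iv w) eq (vt∈iv w k)) (Unique-head u)
  vt-injective (step e b j w) u (suc k) (suc l) eq = cong suc (vt-injective w (Unique-tail u) k l eq)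

  vt-joins : ∀ {B x y} (w : W B x y) i → J (lookup (es w) i) (vt w (inject₁ i)) (vt w (suc i))
  vt-joins (step e b j w) zero    = j
  vt-joins (step e b j w) (suc i) = vt-joins w i

  -- The edge `e` rules out the empty walk, which would violate `len≥1`.
  closed⇒Cycle : ∀ {B x e} (w : W B x x) → Unique (iv w) → Unique (es w) → e ∈ es w →
    Σ (Cycle ends) λ C → (∀ i → B (Cycle.edg C i)) × (∀ {f} → f ∈ es w → OnCycle f C)
  closed⇒Cycle w@(step _ _ _ _) ui ue e∈ =
    record
      { len      = length (es w)
      ; len≥1    = s≤s z≤n
      ; vtx      = vt w
      ; edg      = lookup (es w)
      ; closed   = vt-last w
      ; vtx-inj  = vt-injective w ui
      ; edg-inj  = Unique-lookup ue _ _
      ; edg-join = vt-joins w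
      }
    , (λ i → es-all w (∈-lookup i)) , λ f∈ → index f∈ , sym (lookup-index f∈)

  unroll : ∀ {B} l (vtx : Fin (suc l) → Fin n) (edg : Fin l → Fin m) → (∀ i → B (edg i)) →
           (∀ i → J (edg i) (vtx (inject₁ i)) (vtx (suc i))) →
           Σ (W B (vtx zero) (vtx (fromℕ l))) λ w → (iv w ≡ tabulate (vtx ∘ inject₁)) × (es w ≡ tabulate edg)
  unroll zero    vtx edg b j = here , refl , refl
  unroll (suc l) vtx edg b j with w , p , q ← unroll l (vtx ∘ suc) (edg ∘ suc) (b ∘ suc) (j ∘ suc) =
    step (edg zero) (b zero) (j zero) w , cong (_ ∷_) p , cong (_ ∷_) q

  Cycle⇒closed : ∀ {B} (C : Cycle ends) → (∀ i → B (Cycle.edg C i)) →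
    ∃ λ x → Σ (W B x x) λ w → Unique (iv w) × Unique (es w) × (∀ {f} → OnCycle f C → f ∈ es w)
  Cycle⇒closed {B} C b = close (unroll len vtx edg b edg-join) closed
    where
    open Cycle C
    -- The endpoints are generalised to variables so that the equation `closed` can be matched with
    -- `refl`.
    close : ∀ {x y} → Σ (W B x y) (λ w → (iv w ≡ tabulate (vtx ∘ inject₁)) × (es w ≡ tabulate edg)) → y ≡ x →
      ∃ λ x → Σ (W B x x) λ w → Unique (iv w) × Unique (es w) × (∀ {f} → OnCycle f C → f ∈ es w)
    close (w , p , q) refl = _ , w
      , subst Unique (sym p) (Uniqueₚ.tabulate⁺ (λ {i} {j} → vtx-inj i j))
      , subst Unique (sym q) (Uniqueₚ.tabulate⁺ edg-inj)
      , λ { (i , refl) → subst (edg i ∈_) (sym q) (∈-tabulate⁺ i) }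

  -- Independence of edge sets.

  infixl 6 _∖_
  _∖_ : (Fin m → Set) → Fin m → Fin m → Set
  (B ∖ e) f = B f × f ≢ e

  -- Acyclicity phrased through walks: exchanges cut and reroute walks, and this form follows such
  -- surgery without building cycles. The next lemmas link it to cycles.
  Indep : (Fin m → Set) → Set
  Indep B = ∀ {e x y} → B e → J e x y → ¬ W (B ∖ e) x y

  -- A walk between the ends of `e` that avoids `e` shortens to a path, and `e` closes this path to
  -- a cycle.
  acyclic⇒Indep : ∀ {B} → ¬ (Σ (Cycle ends) λ C → ∀ i → B (Cycle.edg C i)) → Indep B
  acyclic⇒Indep ac {e} {x} {y} Be j w₀ with w , u ← walk⇒path w₀ =
    ac (proj₁ C , proj₁ (proj₂ C))
    where
    w' = mapW proj₁ w
    es-w' = es-retype w (λ _ p → proj₁ (es-all w p))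
    C = closed⇒Cycle (step e Be (swap j) w')
          (Unique-↭ (↭-trans (↭-sym (∷↭∷ʳ y (iv w))) (prep y (↭-reflexive (sym (iv-retype w (λ _ p → proj₁ (es-all w p))))))) u)
          (Unique-∷ (λ p → proj₂ (es-all w (subst (e ∈_) es-w' p)) refl)
            (subst Unique (sym es-w') (path-edges w u)))
          (here refl)

  edge-of : (C : Cycle ends) → ∃ λ e → OnCycle e C
  edge-of C = pick (Cycle.len≥1 C) (Cycle.edg C)
    where
    pick : ∀ {l} → 1 ≤ l → (f : Fin l → Fin m) → ∃ λ e → ∃ λ i → f i ≡ e
    pick (s≤s _) f = f zero , zero , refl

  -- A cycle without its first edge is a walk joining the ends of that edge, and it avoids the edge
  -- because cycle edges are distinct.
  Indep⇒acyclic : ∀ {B} → Indep B → ¬ (Σ (Cycle ends) λ C → ∀ i → B (Cycle.edg C i))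
  Indep⇒acyclic ind (C , b) with Cycle⇒closed C b
  ... | x , here , ui , ue , h = contradiction (h (proj₂ (edge-of C))) λ ()
  ... | x , step e b' j w , ui , ue , h =
    ind b' (swap j) (retype w λ f p → es-all w p , λ { refl → Unique-head ue p })

-- Blocks: transitivity of lying on a common cycle.

module Blocks {n m : ℕ} (ends : Ends n m) where
  open Walks ends

  Every : Fin m → Set
  Every _ = ⊤

  -- Constrains vertices alone, so that arcs are glued by comparing vertex lists; `closed-edges`
  -- recovers distinct edges once `e ≢ f`.
  CoCyclic : Fin m → Fin m → Set
  CoCyclic e f = ∃ λ x → Σ (W Every x x) λ w → Unique (iv w) × e ∈ es w × f ∈ es w

  start∈iv : ∀ {B x y e} (w : W B x y) → e ∈ es w → x ∈ iv w
  start∈iv (step _ _ _ _) _ = here refl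

  start∈iv-≢ : ∀ {B x y} (w : W B x y) → x ≢ y → x ∈ iv w
  start∈iv-≢ here           x≢x = contradiction refl x≢x
  start∈iv-≢ (step _ _ _ _) _   = here refl

  end∈closed : ∀ {B x e a b} (w : W B x x) → e ∈ es w → J e a b → a ∈ iv w
  end∈closed w p j with ∈-++⁻ (iv w) (end∈verts w p j)
  ... | inj₁ q           = q
  ... | inj₂ (here refl) = start∈iv w p

  closed-path : ∀ {B x y} (w : W B y x) → Unique (x ∷ iv w) → Unique (verts w)
  closed-path w = Unique-↭ (∷↭∷ʳ _ (iv w))

  -- The only closed walk with distinct vertices and a repeated edge goes back and forth along it.
  closed-edges : ∀ {B x e f} (w : W B x x) → Unique (iv w) → e ≢ f → e ∈ es w → f ∈ es w → Unique (es w)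
  closed-edges {x = x} {e} {f} (step h _ j w) u e≢f e∈ f∈ = Unique-∷ (h∉ w j uw e∈ f∈) (path-edges w uw)
    where
    uw = closed-path w u
    h∉ : ∀ {y h} (w : W _ y x) → J h x y → Unique (verts w) → e ∈ h ∷ es w → f ∈ h ∷ es w → h ∉ es w
    h∉ (step h' _ j' w) j u e∈ f∈ (there p)   = Unique-head u (end∈verts w p (swap j))
    h∉ (step h' _ j' w) j u e∈ f∈ (here refl) with J-ends j j'
    h∉ (step h' _ j' w) j u e∈ f∈ (here refl) | inj₁ (_ , refl) = Unique-head u (start∈ w)
    -- The closed walk is now `h` there and back, so `e` and `f` would both be `h`.
    h∉ (step h' _ j' here) j u (here refl) (here refl) (here refl) | inj₂ _ = e≢f refl
    h∉ (step h' _ j' here) j u (here refl) (there (here refl)) (here refl) | inj₂ _ = e≢f refl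
    h∉ (step h' _ j' here) j u (there (here refl)) (here refl) (here refl) | inj₂ _ = e≢f refl
    h∉ (step h' _ j' here) j u (there (here refl)) (there (here refl)) (here refl) | inj₂ _ = e≢f refl
    -- A longer path would reach `x` after one edge and once more at its end.
    h∉ (step h' _ j' (step _ _ _ w)) j u e∈ f∈ (here refl) | inj₂ (refl , _) =
      Unique-head (Unique-tail u) (∈-++⁺ʳ (iv w) (here refl))

  CoCyclic⇒SameBlock : ∀ {e f} → CoCyclic e f → SameBlock ends e f
  CoCyclic⇒SameBlock {e} {f} (x , w , u , e∈ , f∈) with e ≟ f
  ... | yes e≡f = inj₁ e≡f
  ... | no  e≢f with C , _ , on ← closed⇒Cycle w u (closed-edges w u e≢f e∈ f∈) e∈ =
    inj₂ (C , on e∈ , on f∈)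

  Cycle⇒CoCyclic : ∀ {e f} (C : Cycle ends) → OnCycle e C → OnCycle f C → CoCyclic e f
  Cycle⇒CoCyclic C e∈ f∈ with x , w , u , _ , on ← Cycle⇒closed {Every} C (λ _ → tt) =
    x , w , u , on e∈ , on f∈

  first-hit : ∀ {B x y} (V : List (Fin n)) (w : W B x y) →
    (∃ λ c → c ∈ V × Σ (W B x c) λ p → Σ (W B c y) λ q → w ≡ p ∙ q × (∀ {v} → v ∈ iv p → v ∉ V)) ⊎
    (∀ {v} → v ∈ verts w → v ∉ V)
  first-hit {x = x} V w with x ∈? V
  first-hit V w | yes x∈ = inj₁ (_ , x∈ , here , w , refl , λ ())
  first-hit V here | no x∉ = inj₂ λ { (here refl) → x∉ }
  first-hit V (step e b j w) | no x∉ with first-hit V w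
  ... | inj₁ (c , c∈ , p , q , refl , off) =
    inj₁ (c , c∈ , step e b j p , q , refl , λ { (here refl) → x∉ ; (there r) → off r })
  ... | inj₂ off = inj₂ λ { (here refl) → x∉ ; (there r) → off r }

  last-hit : ∀ {B x y} (V : List (Fin n)) (w : W B x y) →
    (∃ λ d → d ∈ V × Σ (W B x d) λ p → Σ (W B d y) λ q → w ≡ p ∙ q × (∀ {v} → v ∈ tv q → v ∉ V)) ⊎
    (∀ {v} → v ∈ verts w → v ∉ V)
  last-hit {x = x} V here with x ∈? V
  ... | yes x∈ = inj₁ (_ , x∈ , here , here , refl , λ ())
  ... | no  x∉ = inj₂ λ { (here refl) → x∉ }
  last-hit {x = x} V (step e b j w) with last-hit V w
  ... | inj₁ (d , d∈ , p , q , refl , off) = inj₁ (d , d∈ , step e b j p , q , refl , off)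
  ... | inj₂ off with x ∈? V
  ...   | yes x∈ = inj₁ (_ , x∈ , here , step e b j w , refl , λ r → off (subst (_ ∈_) (sym (verts-tv w)) r))
  ...   | no  x∉ = inj₂ λ { (here refl) → x∉ ; (there r) → off r }

  -- `A` and `B` are the two arcs of a cycle and `Q` is an ear with the same feet; the new cycle
  -- `Q ∙ A` puts the ear in place of `B`.
  ear-join : ∀ {c d e g} (A : W Every c d) (B : W Every d c) (Q : W Every d c) → c ≢ d →
    Unique (iv A ++ iv B) → Unique (iv Q) → (∀ {v} → v ∈ iv Q → v ≡ d ⊎ v ∉ iv A) →
    e ∈ es A → g ∈ es Q → CoCyclic e g
  ear-join {c} {d} {e} {g} A B Q c≢d uAB uQ off e∈ g∈ = d , Q ∙ A
    , subst Unique (sym (iv-∙ Q A)) (Uniqueₚ.++⁺ uQ (Unique-++ˡ (iv A) uAB) disjoint)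
    , subst (e ∈_) (sym (es-∙ Q A)) (∈-++⁺ʳ (es Q) e∈)
    , subst (g ∈_) (sym (es-∙ Q A)) (∈-++⁺ˡ g∈)
    where
    disjoint : ∀ {v} → ¬ (v ∈ iv Q × v ∈ iv A)
    disjoint (p , q) with off p
    -- As `c ≢ d`, the arc `B` is nonempty, so its start `d` is in `iv B` and cannot be in `iv A`.
    ... | inj₁ refl = Unique-disjoint (iv A) uAB q (start∈iv-≢ B (c≢d ∘ sym))
    ... | inj₂ v∉   = v∉ q

  -- Rotate the cycle to start at `c` and cut it at `d`. The ear is joined to whichever arc carries
  -- `e`; if that is the arc from `d` back to `c`, both arcs are reversed so that the ear keeps its
  -- direction.
  add-ear : ∀ {x c d e g} (w : W Every x x) → Unique (iv w) → e ∈ es w → c ∈ iv w → d ∈ iv w → c ≢ d →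
    (Q : W Every d c) → Unique (iv Q) → (∀ {v} → v ∈ iv Q → v ≡ d ⊎ v ∉ iv w) → g ∈ es Q → CoCyclic e g
  add-ear {x} {c} {d} {e} w u e∈ c∈ d∈ c≢d Q uQ off g∈ with split-vertex w c∈
  ... | p , q , refl = go (split-vertex (q ∙ p) (∈-resp-↭ rot d∈))
    where
    rot : iv (p ∙ q) ↭ iv (q ∙ p)
    rot = ↭-trans (↭-reflexive (iv-∙ p q)) (↭-trans (++-comm (iv p) (iv q)) (↭-reflexive (sym (iv-∙ q p))))
    rot-es : es (p ∙ q) ↭ es (q ∙ p)
    rot-es = ↭-trans (↭-reflexive (es-∙ p q)) (↭-trans (++-comm (es p) (es q)) (↭-reflexive (sym (es-∙ q p))))
    go : (Σ (W Every c d) λ A → Σ (W Every d c) λ B → q ∙ p ≡ A ∙ B) → CoCyclic e _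
    go (A , B , eq) = arc (∈-++⁻ (es A) (subst (e ∈_) es-eq (∈-resp-↭ rot-es e∈)))
      where
      es-eq : es (q ∙ p) ≡ es A ++ es B
      es-eq = trans (cong es eq) (es-∙ A B)
      iv↭ : iv (p ∙ q) ↭ iv A ++ iv B
      iv↭ = ↭-trans rot (↭-reflexive (trans (cong iv eq) (iv-∙ A B)))
      iv-rev↭ : iv (rev B) ++ iv (rev A) ↭ iv A ++ iv B
      iv-rev↭ = ↭-trans (++⁺ (iv-rev B) (iv-rev A)) (↭-trans (++-comm (tv B) (tv A))
        (↭-trans (↭-reflexive (sym (tv-∙ A B))) (↭-trans (tv↭iv (A ∙ B)) (↭-reflexive (iv-∙ A B)))))
      off' : ∀ {ws zs v} → ws ++ zs ↭ iv A ++ iv B → v ∈ iv Q → v ≡ d ⊎ v ∉ ws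
      off' r p with off p
      ... | inj₁ v≡d = inj₁ v≡d
      ... | inj₂ v∉  = inj₂ λ v∈ → v∉ (∈-resp-↭ (↭-trans r (↭-sym iv↭)) (∈-++⁺ˡ v∈))
      uAB = Unique-↭ iv↭ u
      arc : e ∈ es A ⊎ e ∈ es B → CoCyclic e _
      arc (inj₁ e∈A) = ear-join A B Q c≢d uAB uQ (off' {zs = iv B} ↭-refl) e∈A g∈
      arc (inj₂ e∈B) = ear-join (rev B) (rev A) Q c≢d (Unique-↭ (↭-sym iv-rev↭) uAB) uQ
        (off' {zs = iv (rev A)} iv-rev↭) (∈-resp-↭ (↭-sym (es-rev B)) e∈B) g∈

  -- Rotating the closed walk to start just after `g` and dropping `g` leaves a path between the
  -- ends of `g`.
  open-at : ∀ {B x g} (w : W B x x) → Unique (iv w) → g ∈ es w →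
    ∃ λ a → ∃ λ b → J g a b × Σ (W B b a) λ p → Unique (verts p) × es w ↭ g ∷ es p
  open-at {g = g} w u g∈ with a , b , j , _ , p , q , iv≡ , es≡ ← split-edge w g∈ = a , b , j , q ∙ p
    , closed-path (q ∙ p) (Unique-↭ (↭-trans (↭-reflexive iv≡)
        (↭-trans (++-comm (iv p) (a ∷ iv q)) (prep a (↭-reflexive (sym (iv-∙ q p)))))) u)
    , ↭-trans (↭-reflexive es≡) (↭-trans (++-comm (es p) (g ∷ es q)) (prep g (↭-reflexive (sym (es-∙ q p)))))

  -- The arc of the second cycle through g between its first and last vertices on
  -- the first cycle is an ear; its feet differ because both ends of f lie on the first cycle.
  CoCyclic-trans : ∀ {e f g} → f ≢ g → CoCyclic e f → CoCyclic f g → CoCyclic e g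
  CoCyclic-trans {e} {f} {g} f≢g (x , w , u , e∈ , f∈) (x' , w' , u' , f∈' , g∈') with open-at w' u' g∈'
  ... | a , b , jg , R , uR , es↭ = strip (first-hit V R)
    where
    V = iv w
    f∈R : f ∈ es R
    f∈R with ∈-resp-↭ es↭ f∈'
    ... | here f≡g = contradiction f≡g f≢g
    ... | there r  = r
    -- Both ends of `f` are in `V`, so the two outer stretches of `R`, which stay off `V` except at
    -- their feet, cannot contain `f`; it lies in the middle stretch `M`.
    f∉source : ∀ {y z} (v : W Every y z) → (∀ {c} → c ∈ iv v → c ∉ V) → f ∉ es v
    f∉source v off r with _ , _ , j , s ← source∈iv v r = off s (end∈closed w f∈ j)
    f∉target : ∀ {y z} (v : W Every y z) → (∀ {c} → c ∈ tv v → c ∉ V) → f ∉ es v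
    f∉target v off r with _ , _ , j , s ← target∈tv v r = off s (end∈closed w f∈ (swap j))
    strip : _ → CoCyclic e g
    strip (inj₂ off) = contradiction f∈R (f∉source R (off ∘ ∈-++⁺ˡ))
    strip (inj₁ (c , c∈ , R₁ , R' , R≡ , off₁)) = strip' (last-hit V R')
      where
      f∈R' : f ∈ es R'
      f∈R' with ∈-++⁻ (es R₁) (subst (f ∈_) (trans (cong es R≡) (es-∙ R₁ R')) f∈R)
      ... | inj₁ r = contradiction r (f∉source R₁ off₁)
      ... | inj₂ r = r
      strip' : _ → CoCyclic e g
      strip' (inj₂ off) = contradiction f∈R' (f∉source R' (off ∘ ∈-++⁺ˡ))
      strip' (inj₁ (d , d∈ , M , R₂ , R'≡ , off₂)) =
        add-ear w u e∈ c∈ d∈ c≢d Q uQ offQ (subst (g ∈_) (sym (es-∙ R₂ _)) (∈-++⁺ʳ (es R₂) (here refl)))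
        where
        f∈M : f ∈ es M
        f∈M with ∈-++⁻ (es M) (subst (f ∈_) (trans (cong es R'≡) (es-∙ M R₂)) f∈R')
        ... | inj₁ r = r
        ... | inj₂ r = contradiction r (f∉target R₂ off₂)
        iv-R : verts R ≡ iv R₁ ++ iv M ++ verts R₂
        iv-R = trans (cong (_++ [ a ]) (trans (cong iv (trans R≡ (cong (R₁ ∙_) R'≡)))
          (trans (iv-∙ R₁ (M ∙ R₂)) (cong (iv R₁ ++_) (iv-∙ M R₂)))))
          (trans (++-assoc (iv R₁) (iv M ++ iv R₂) [ a ]) (cong (iv R₁ ++_) (++-assoc (iv M) (iv R₂) [ a ])))
        uMR : Unique (iv M ++ iv R₁ ++ verts R₂)
        uMR = Unique-↭ (shifts (iv R₁) (iv M)) (subst Unique iv-R uR)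
        c≢d : c ≢ d
        -- Since `f` is on `M`, `M` is nonempty; with equal feet the path `R` would visit `c` at
        -- both ends of `M`.
        c≢d refl = Unique-disjoint (iv M) uMR (start∈iv M f∈M) (∈-++⁺ʳ (iv R₁) (start∈ R₂))
        -- The ear follows `R₂` from `d` to `a`, crosses `g` to `b`, and follows `R₁` to `c`.
        Q : W Every d c
        Q = R₂ ∙ step g tt jg R₁
        iv-Q : iv Q ≡ verts R₂ ++ iv R₁
        iv-Q = trans (iv-∙ R₂ _) (sym (++-assoc (iv R₂) [ a ] (iv R₁)))
        uQ : Unique (iv Q)
        uQ = subst Unique (sym iv-Q) (Unique-↭ (++-comm (iv R₁) (verts R₂)) (Unique-++ʳ (iv M) uMR))
        offQ : ∀ {v} → v ∈ iv Q → v ≡ d ⊎ v ∉ V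
        offQ {v} r with ∈-++⁻ (verts R₂) (subst (v ∈_) iv-Q r)
        ... | inj₂ s = inj₂ (off₁ s)
        ... | inj₁ s with subst (v ∈_) (verts-tv R₂) s
        ...   | here v≡d = inj₁ v≡d
        ...   | there t  = inj₂ (off₂ t)

  SameBlock-sym : ∀ {e f} → SameBlock ends e f → SameBlock ends f e
  SameBlock-sym (inj₁ e≡f)             = inj₁ (sym e≡f)
  SameBlock-sym (inj₂ (C , e∈ , f∈)) = inj₂ (C , f∈ , e∈)

  SameBlock-trans : ∀ {e f g} → SameBlock ends e f → SameBlock ends f g → SameBlock ends e g
  SameBlock-trans (inj₁ refl) r           = r
  SameBlock-trans l           (inj₁ refl) = l
  SameBlock-trans {e} {f} {g} l@(inj₂ (C , e∈ , f∈)) (inj₂ (D , f∈' , g∈)) with f ≟ g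
  ... | yes refl = l
  ... | no  f≢g  = CoCyclic⇒SameBlock
    (CoCyclic-trans f≢g (Cycle⇒CoCyclic C e∈ f∈) (Cycle⇒CoCyclic D f∈' g∈))

-- Exchanges in spanning trees.

module Trees {n m : ℕ} (ends : Ends n m) where
  open Walks ends
  open Blocks ends

  replace : (Fin m → Set) → Fin m → Fin m → Fin m → Set
  replace B e x f = (B ∖ e) f ⊎ f ≡ x

  -- The walks `p` and `q` say that `e` lies on the cycle closed by `x`. Each use of `e` can thus
  -- detour through `x`, while in `B ∖ e` the ends of `x` are separated, since a connection would
  -- join the ends of `e`.
  exchange : ∀ {B e x u v a b} → IsSpanningTree ends B → B e → J x u v → J e a b →
             W (B ∖ e) u a → W (B ∖ e) b v → IsSpanningTree ends (replace B e x)
  exchange {B} {e} {x} {u} {v} {a} {b} (con , ac) Be jx je p q =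
    (λ y z → reroute (con y z)) , Indep⇒acyclic ind
    where
    indB : Indep B
    indB = acyclic⇒Indep ac
    detour : W (replace B e x) a b
    detour = rev (mapW inj₁ p) ∙ step x (inj₂ refl) jx (rev (mapW inj₁ q))
    reroute : ∀ {y z} → W B y z → W (replace B e x) y z
    reroute here = here
    reroute (step f Bf j w) with f ≟ e
    ... | no  f≢e  = step f (inj₁ (Bf , f≢e)) j (reroute w)
    ... | yes refl with J-ends j je
    ...   | inj₁ (refl , refl) = detour ∙ reroute w
    ...   | inj₂ (refl , refl) = rev detour ∙ reroute w
    separated : ¬ W (B ∖ e) u v
    separated w = indB Be je (rev p ∙ w ∙ rev q)
    ind : Indep (replace B e x)
    ind {f} (inj₂ refl) j w = closes (J-ends jx j)
      where
      w' : W (B ∖ e) _ _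
      w' = mapW (λ { (inj₁ r , _) → r ; (inj₂ f≡x , f≢x) → contradiction f≡x f≢x }) w
      closes : _ → _
      closes (inj₁ (refl , refl)) = separated w'
      closes (inj₂ (refl , refl)) = separated (rev w')
    -- A walk between the ends of an old edge `f` is cut at `x`. Without `x` it contradicts `indB`;
    -- otherwise its two pieces and `f` connect `u` to `v` in `B ∖ e`.
    ind {f} (inj₁ (Bf , f≢e)) j w = closes (cross {A = B ∖ e ∖ f} jx
        (λ { (inj₁ r , g≢f) → inj₁ (r , g≢f) ; (inj₂ g≡x , _) → inj₂ g≡x }) w)
      where
      closes : _ → _
      closes (inj₁ r)              = indB Bf j (mapW (λ { ((Bg , _) , g≢f) → Bg , g≢f }) r)
      closes (inj₂ (inj₁ (r , s))) = separated (mapW proj₁ (rev r) ∙ step f (Bf , f≢e) j (mapW proj₁ (rev s)))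
      closes (inj₂ (inj₂ (r , s))) = separated (mapW proj₁ s ∙ step f (Bf , f≢e) (swap j) (mapW proj₁ r))

  IsSpanningTree-resp : ∀ {A B : Fin m → Set} → (∀ {e} → A e → B e) → (∀ {e} → B e → A e) →
                        IsSpanningTree ends A → IsSpanningTree ends B
  IsSpanningTree-resp f g (con , ac) = (λ x y → mapW f (con x y)) , λ { (C , b) → ac (C , g ∘ b) }

  Indep-anti : ∀ {A B : Fin m → Set} → (∀ {e} → A e → B e) → Indep B → Indep A
  Indep-anti f ind a j w = ind (f a) j (mapW (λ { (a' , ne) → f a' , ne }) w)

  indep : (T : LST ends) → Indep (InTree T)
  indep T = acyclic⇒Indep (proj₂ (tree T))

  inTree? : (T : LST ends) (e : Fin m) → Dec (InTree T e)
  inTree? T e = Finₚ.any? (λ i → lab T i ≟ e)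

  Replaces : LST ends → LST ends → Fin (n ∸ 1) → Fin m → Set
  Replaces T T' j x = lab T' j ≡ x × (∀ k → k ≢ j → lab T' k ≡ lab T k)

  replaceLabel : (T : LST ends) (j : Fin (n ∸ 1)) {x : Fin m} → ¬ InTree T x →
    IsSpanningTree ends (replace (InTree T) (lab T j) x) → Σ (LST ends) λ T' → Replaces T T' j x
  replaceLabel T j {x} x∉ t = record { lab = l ; lab-inj = inj _ _ ; tree = IsSpanningTree-resp to from t }
    , same , other
    where
    l = updateAt (lab T) j (λ _ → x)
    same : l j ≡ x
    same = updateAt-updates j (lab T)
    other : ∀ k → k ≢ j → l k ≡ lab T k
    other k = updateAt-minimal k j (lab T)
    inj : ∀ k k' → l k ≡ l k' → k ≡ k'
    inj k k' eq with k ≟ j | k' ≟ j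
    ... | yes refl | yes refl = refl
    ... | yes refl | no  k'≢j = contradiction (k' , trans (sym (other k' k'≢j)) (trans (sym eq) same)) x∉
    ... | no  k≢j  | yes refl = contradiction (k , trans (sym (other k k≢j)) (trans eq same)) x∉
    ... | no  k≢j  | no  k'≢j = lab-inj T (trans (sym (other k k≢j)) (trans eq (other k' k'≢j)))
    to : ∀ {e} → replace (InTree T) (lab T j) x e → ∃ λ i → l i ≡ e
    to (inj₁ ((k , refl) , ne)) = k , other k (λ { refl → ne refl })
    to (inj₂ refl)              = j , same
    from : ∀ {e} → (∃ λ i → l i ≡ e) → replace (InTree T) (lab T j) x e
    from (k , refl) with k ≟ j
    ... | yes refl = inj₂ same
    ... | no  k≢j  = inj₁ ((k , sym (other k k≢j)) , λ eq → k≢j (lab-inj T (trans (sym (other k k≢j)) eq)))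

  -- Cutting the tree path at the edge labelled `j` gives the two walks that `exchange` takes; both
  -- avoid that edge because the edges of a path are distinct.
  replace-on-path : (T : LST ends) (j : Fin (n ∸ 1)) {x : Fin m} {u v : Fin n} → ¬ InTree T x → J x u v →
    (w : W (InTree T) u v) → Unique (verts w) → lab T j ∈ es w → Σ (LST ends) λ T' → Replaces T T' j x
  replace-on-path T j {x} x∉ jx w u e∈ with a , b , je , Be , p , q , _ , es≡ ← split-edge w e∈ =
    replaceLabel T j x∉ (exchange (tree T) Be jx je
      (retype p λ f f∈ → es-all p f∈ , λ { refl → Unique-head ue (∈-++⁺ˡ f∈) })
      (retype q λ f f∈ → es-all q f∈ , λ { refl → Unique-head ue (∈-++⁺ʳ (es p) f∈) }))
    where
    ue : Unique (lab T j ∷ es p ++ es q)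
    ue = Unique-↭ (↭-trans (↭-reflexive es≡) (shift (lab T j) (es p) (es q))) (path-edges w u)

  Replaces⇒ExchangeStep : ∀ {T T' : LST ends} {j x} → ¬ InTree T x → Replaces T T' j x → ExchangeStep T T'
  Replaces⇒ExchangeStep {T} {j = j} x∉ (same , other) = j , other , λ p → x∉ (subst (InTree T) same p)

  -- Composing, reversing and relabelling sequences of exchanges.

  Steps-refl : ∀ {T : LST ends} → Steps 0 T T
  Steps-refl = done (λ _ → refl)

  Steps-respˡ : ∀ {k} {T T' T'' : LST ends} → T ≈T T' → Steps k T' T'' → Steps k T T''
  Steps-respˡ eq (done eq') = done (λ i → trans (eq i) (eq' i))
  Steps-respˡ eq (more (j , other , fresh) s) =
    more (j , (λ i i≢j → trans (other i i≢j) (sym (eq i))) , λ { (i , p) → fresh (i , trans (sym (eq i)) p) }) s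

  Steps-trans : ∀ {k l} {T T' T'' : LST ends} → Steps k T T' → Steps l T' T'' → Steps (k + l) T T''
  Steps-trans (done eq)  t = Steps-respˡ eq t
  Steps-trans (more x s) t = more x (Steps-trans s t)

  ExchangeStep-sym : ∀ {T T' : LST ends} → ExchangeStep T T' → ExchangeStep T' T
  ExchangeStep-sym {T} {T'} (j , other , fresh) = j , (λ i i≢j → sym (other i i≢j)) , fresh'
    where
    fresh' : ¬ InTree T' (lab T j)
    fresh' (i , eq) with i ≟ j
    ... | yes refl = fresh (j , sym eq)
    ... | no  i≢j  = i≢j (lab-inj T (trans (sym (other i i≢j)) eq))

  Steps-snoc : ∀ {k} {T T' T'' : LST ends} → Steps k T T' → ExchangeStep T' T'' → Steps (suc k) T T''
  Steps-snoc {T' = T'} (done eq) x = Steps-respˡ {T' = T'} eq (more x Steps-refl)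
  Steps-snoc (more y s) x = more y (Steps-snoc s x)

  Steps-sym : ∀ {k} {T T' : LST ends} → Steps k T T' → Steps k T' T
  Steps-sym (done eq)  = done (λ i → sym (eq i))
  Steps-sym {T = T} (more {T' = T'} x s) = Steps-snoc (Steps-sym s) (ExchangeStep-sym {T} {T'} x)

  relabel : LST ends → Permutation′ (n ∸ 1) → LST ends
  relabel T π = record
    { lab     = λ i → lab T (π ⟨$⟩ʳ i)
    ; lab-inj = λ eq → trans (sym (inverseˡ π)) (trans (cong (π ⟨$⟩ˡ_) (lab-inj T eq)) (inverseˡ π))
    ; tree    = IsSpanningTree-resp
        (λ { (i , eq) → π ⟨$⟩ˡ i , trans (cong (lab T) (inverseʳ π)) eq })
        (λ { (i , eq) → π ⟨$⟩ʳ i , eq })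
        (tree T)
    }

  ∈-relabel : ∀ (T : LST ends) π {e} → InTree T e → InTree (relabel T π) e
  ∈-relabel T π (i , eq) = π ⟨$⟩ˡ i , trans (cong (lab T) (inverseʳ π)) eq

  ExchangeStep-relabel : ∀ {T T' : LST ends} π → ExchangeStep T T' → ExchangeStep (relabel T π) (relabel T' π)
  ExchangeStep-relabel {T} {T'} π (j , other , fresh) = π ⟨$⟩ˡ j
    , (λ i i≢ → other _ (λ { refl → i≢ (sym (inverseˡ π)) }))
    , λ { (i , eq) → fresh (_ , trans eq (cong (lab T') (inverseʳ π))) }

  -- Exchanges commute with permuting labels. This allows an absorption to be undone after two
  -- labels have been swapped.
  Steps-relabel : ∀ {k} {T T' : LST ends} π → Steps k T T' → Steps k (relabel T π) (relabel T' π)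
  Steps-relabel π (done eq)  = done (λ i → eq _)
  Steps-relabel {T = T} π (more {T' = T'} x s) =
    more (ExchangeStep-relabel {T} {T'} π x) (Steps-relabel π s)

  -- The path of `T` between the ends of the new edge must use the removed one: otherwise it
  -- survives in `T'` and closes a cycle there. Path and new edge then form a common cycle.
  SameBlock-step : ∀ {T T' : LST ends} → ExchangeStep T T' → ∀ i → SameBlock ends (lab T i) (lab T' i)
  SameBlock-step {T} {T'} (j , other , fresh) i with i ≟ j
  ... | no  i≢j  = inj₁ (sym (other i i≢j))
  ... | yes refl with walk⇒path (proj₁ (tree T) (proj₁ (ends (lab T' i))) (proj₂ (ends (lab T' i))))
  ...   | w , u with lab T i ∈? es w
  ...     | yes e∈ = CoCyclic⇒SameBlock (_ , step (lab T' i) tt (inj₂ refl) w'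
              , subst Unique (cong (_ ∷_) (sym (iv-retype w _))) (Unique-↭ (↭-sym (∷↭∷ʳ _ (iv w))) u)
              , there (subst (lab T i ∈_) (sym (es-retype w _)) e∈) , here refl)
    where w' = mapW {B = Every} (λ _ → tt) w
  ...     | no  e∉ = contradiction (retype w moved) (indep T' (i , refl) (inj₁ refl))
    where
    moved : ∀ f → f ∈ es w → (InTree T' ∖ lab T' i) f
    moved f f∈ with es-all w f∈
    ... | k , refl = (k , other k (λ { refl → e∉ f∈ })) , λ eq → fresh (k , eq)

  SameBlock-steps : ∀ {k} {T T' : LST ends} → Steps k T T' → ∀ i → SameBlock ends (lab T i) (lab T' i)
  SameBlock-steps (done eq)  i = inj₁ (eq i)
  SameBlock-steps {T = T} (more {T' = T'} x s) i = SameBlock-trans (SameBlock-step {T} {T'} x i) (SameBlock-steps s i)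

  -- Absorbing an independent edge set into a tree.

  -- The tree path between the ends of a missing `x` has an edge outside `L`, or else it would
  -- contradict `ind`; that edge gives up its label to `x`. `L` stays fixed while `xs` shrinks,
  -- which protects edges absorbed earlier.
  absorb : (L : List (Fin m)) → Indep (_∈ L) → (xs : List (Fin m)) → (∀ {e} → e ∈ xs → e ∈ L) → (T : LST ends) →
    Σ (LST ends) λ T' → (∃ λ k → k ≤ length xs × Steps k T T') ×
      (∀ {e} → e ∈ xs → InTree T' e) × (∀ i → lab T i ∈ L → lab T' i ≡ lab T i)
  absorb L ind []       xs⊆ T = T , (0 , z≤n , Steps-refl) , (λ ()) , λ _ _ → refl
  absorb L ind (x ∷ xs) xs⊆ T with inTree? T x
  absorb L ind (x ∷ xs) xs⊆ T | yes (i , refl) with absorb L ind xs (xs⊆ ∘ there) T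
  ... | T' , (k , k≤ , s) , has , keep = T' , (k , m≤n⇒m≤1+n k≤ , s)
    , (λ { (here refl) → i , keep i (xs⊆ (here refl)) ; (there p) → has p }) , keep
  absorb L ind (x ∷ xs) xs⊆ T | no x∉ with walk⇒path (proj₁ (tree T) (proj₁ (ends x)) (proj₂ (ends x)))
  ... | w , u with any? (λ e → ¬? (e ∈? L)) (es w)
  ...   | no all∈ = contradiction
            (retype w λ f f∈ → decidable-stable (f ∈? L) (λ f∉ → all∈ (lose f∈ f∉)) , λ { refl → x∉ (es-all w f∈) })
            (ind (xs⊆ (here refl)) (inj₁ refl))
  ...   | yes some with find some
  ...     | e , e∈ , e∉L with es-all w e∈
  ...       | j , refl with replace-on-path T j x∉ (inj₁ refl) w u e∈
  ...         | T₁ , r@(same , other) with absorb L ind xs (xs⊆ ∘ there) T₁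
  ...           | T' , (k , k≤ , s) , has , keep = T'
                  , (suc k , s≤s k≤ , more (Replaces⇒ExchangeStep {T} {T₁} x∉ r) s)
                  , (λ { (here refl) → j , trans (keep j (subst (_∈ L) (sym same) (xs⊆ (here refl)))) same ; (there p) → has p })
                  , kept
    where
    kept : ∀ i → lab T i ∈ L → lab T' i ≡ lab T i
    kept i i∈ = trans (keep i (subst (_∈ L) (sym eq) i∈)) eq
      where
      eq : lab T₁ i ≡ lab T i
      eq = other i (λ { refl → e∉L i∈ })

  avoids : ∀ {A B x y z c} (w : W B y z) → (∀ {e} → A e → e ∈ es w) → x ∉ verts w → W A x c → x ≡ c
  avoids w A⊆ x∉ here           = refl
  avoids w A⊆ x∉ (step e a j _) = contradiction (end∈verts w (A⊆ a) j) x∉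

  -- Induction along the path: the later edges do not touch its first vertex, so by `avoids` a walk
  -- over them can neither leave nor reach it.
  path-Indep : ∀ {B x y} (w : W B x y) → Unique (verts w) → Indep (_∈ es w)
  path-Indep {x = x} (step e _ j w) u {f} {a} {c} f∈ j' ω = closes f∈
    where
    x∉ = Unique-head u
    Rest : Fin m → Set
    Rest f = f ∈ es w
    closes : f ∈ e ∷ es w → _
    closes (here refl) with J-ends j j'
    ... | inj₁ (refl , refl) = x∉ (subst (_∈ verts w) (sym (avoids w id x∉ (mapW drop ω))) (start∈ w))
      where
      drop : ∀ {g} → ((_∈ f ∷ es w) ∖ f) g → Rest g
      drop (here g≡f , g≢f) = contradiction g≡f g≢f
      drop (there p  , _)   = p
    ... | inj₂ (refl , refl) = x∉ (subst (_∈ verts w) (sym (avoids w id x∉ (rev (mapW drop ω)))) (start∈ w))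
      where
      drop : ∀ {g} → ((_∈ f ∷ es w) ∖ f) g → Rest g
      drop (here g≡f , g≢f) = contradiction g≡f g≢f
      drop (there p  , _)   = p
    closes (there p) with cross {A = Rest ∖ f} j (λ { (here g≡e , _) → inj₂ g≡e ; (there q , g≢f) → inj₁ (q , g≢f) }) ω
    ... | inj₁ r              = path-Indep w (Unique-tail u) p j' r
    ... | inj₂ (inj₁ (r , _)) = x∉ (subst (_∈ verts w) (sym (avoids w proj₁ x∉ (rev r))) (end∈verts w p j'))
    ... | inj₂ (inj₂ (_ , r)) = x∉ (subst (_∈ verts w) (sym (avoids w proj₁ x∉ r)) (end∈verts w p (swap j')))

  es-length : ∀ {B x y} (w : W B x y) → length (es w) ≡ length (iv w)
  es-length here           = refl
  es-length (step e b j w) = cong suc (es-length w)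

  path-length : ∀ {B x y} (w : W B x y) → Unique (verts w) → length (es w) ≤ n
  path-length w u = subst (_≤ n) (sym (es-length w))
    (injective⇒≤ (λ {i} {j} → Unique-lookup (Unique-++ˡ (iv w) u) i j))

-- Values of a transposition.

module _ {k : ℕ} (i j : Fin k) where

  transpose-fst : Perm.transpose i j ⟨$⟩ʳ i ≡ j
  transpose-fst rewrite dec-true (i ≟ i) refl = refl

  transpose-snd : Perm.transpose i j ⟨$⟩ʳ j ≡ i
  transpose-snd with j ≟ i
  ... | yes j≡i = j≡i
  ... | no  j≢i rewrite dec-true (j ≟ j) refl = refl

  transpose-other : ∀ {l} → l ≢ i → l ≢ j → Perm.transpose i j ⟨$⟩ʳ l ≡ l
  transpose-other {l} l≢i l≢j rewrite dec-false (l ≟ i) l≢i | dec-false (l ≟ j) l≢j = refl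

-- Sorting labels inside blocks.

module Sorting {n m : ℕ} (ends : Ends n m) (simple : Simple ends) where
  open Walks ends
  open Blocks ends
  open Trees ends

  pick-third : ∀ {a b c : Fin m} e f → Unique (a ∷ b ∷ c ∷ []) → ∃ λ g → g ∈ a ∷ b ∷ c ∷ [] × g ≢ e × g ≢ f
  pick-third {a} {b} {c} e f ((a≢b ∷ a≢c ∷ []) ∷ (b≢c ∷ []) ∷ _) with a ≟ e | a ≟ f | b ≟ e | b ≟ f
  ... | no a≢e   | no a≢f   | _        | _        = a , here refl , a≢e , a≢f
  ... | _        | _        | no b≢e   | no b≢f   = b , there (here refl) , b≢e , b≢f
  ... | yes refl | _        | yes refl | _        = contradiction refl a≢b
  ... | _        | yes refl | _        | yes refl = contradiction refl a≢b
  ... | yes refl | _        | no _     | yes refl = c , there (there (here refl)) , ≢-sym a≢c , ≢-sym b≢c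
  ... | no _     | yes refl | yes refl | no _     = c , there (there (here refl)) , ≢-sym b≢c , ≢-sym a≢c

  loopless : ∀ {e x} → ¬ J e x x
  loopless {e} (inj₁ p) with x≡ , y≡ ← ,-injective p = proj₁ simple e (trans x≡ (sym y≡))
  loopless {e} (inj₂ p) with x≡ , y≡ ← ,-injective p = proj₁ simple e (trans x≡ (sym y≡))

  no-parallel : ∀ {e f x y} → J e x y → J f x y → e ≡ f
  no-parallel {e} {f} j j' = proj₂ simple e f (same j j')
    where
    same : ∀ {x y} → J e x y → J f x y → (ends e ≡ ends f) ⊎ (ends e ≡ Data.Product.swap (ends f))
    same (inj₁ p) (inj₁ q) = inj₁ (trans p (sym q))
    same (inj₁ p) (inj₂ q) = inj₂ (trans p (cong Data.Product.swap (sym q)))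
    same (inj₂ p) (inj₁ q) = inj₂ (trans p (cong Data.Product.swap (sym q)))
    same (inj₂ p) (inj₂ q) = inj₁ (trans p (sym q))

  -- A closed walk of one edge would be a loop and one of two distinct edges a parallel pair, so
  -- there are at least three edges to choose from.
  third-edge : ∀ {B x} (w : W B x x) e f → Unique (es w) → e ∈ es w → ∃ λ g → g ∈ es w × g ≢ e × g ≢ f
  third-edge (step a _ j here) e f u e∈ = contradiction j loopless
  third-edge (step a _ j (step b _ j' here)) e f u e∈ =
    contradiction (here (no-parallel j (swap j'))) (Unique-head u)
  third-edge (step a _ _ (step b _ _ (step c _ _ w))) e f u e∈
    with g , g∈ , ne ← pick-third e f (Unique-++ˡ (a ∷ b ∷ c ∷ []) u) = g , ∈-++⁺ˡ g∈ , ne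

  -- On a cycle whose edges other than g all lie in T, three exchanges swap two labels:
  -- g takes the place of lab T i, then lab T i that of lab T j, then lab T j that of g.
  swap-on-path : ∀ {u v g} (T : LST ends) {i j} → i ≢ j → J g u v → ¬ InTree T g → (p : W Every u v) →
    Unique (verts p) → (∀ {e} → e ∈ es p → InTree T e) → lab T i ∈ es p → lab T j ∈ es p →
    Steps 3 T (relabel T (Perm.transpose i j))
  swap-on-path {u} {v} {g} T {i} {j} i≢j jg g∉ p up p⊆T i∈ j∈ =
    go (replace-path T g∉ p⊆T i∈) (replace-path T' g∉' (∈-relabel T π ∘ p⊆T)
         (subst (_∈ es p) (sym (cong (lab T) (transpose-fst i j))) j∈))
    where
    π = Perm.transpose i j
    T' = relabel T π
    g∉' : ¬ InTree T' g
    g∉' (k , eq) = g∉ (_ , eq)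
    replace-path : (S : LST ends) → ¬ InTree S g → (∀ {e} → e ∈ es p → InTree S e) → lab S i ∈ es p →
                   Σ (LST ends) λ S' → Replaces S S' i g
    replace-path S g∉S p⊆S e∈ = replace-on-path S i g∉S jg (retype p (λ _ → p⊆S))
      (subst (λ vs → Unique (vs ++ [ v ])) (sym (iv-retype p (λ _ → p⊆S))) up)
      (subst (lab S i ∈_) (sym (es-retype p (λ _ → p⊆S))) e∈)
    go : _ → _ → Steps 3 T T'
    -- `T₂` is made from the target `T'`, not from `T₁`: both carry `g` at `i` and so differ only at
    -- `j`. The third exchange is the reverse of the one leading from `T'` to `T₂`.
    go (T₁ , r₁@(same₁ , other₁)) (T₂ , r₂@(same₂ , other₂)) =
      more {T' = T₁} (Replaces⇒ExchangeStep {T} {T₁} g∉ r₁)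
        (more {T' = T₂} (j , other , fresh)
          (more (ExchangeStep-sym {T'} {T₂} (Replaces⇒ExchangeStep {T'} {T₂} g∉' r₂)) Steps-refl))
      where
      other : ∀ k → k ≢ j → lab T₂ k ≡ lab T₁ k
      other k k≢j with k ≟ i
      ... | yes refl = trans same₂ (sym same₁)
      ... | no  k≢i  = trans (other₂ k k≢i)
        (trans (cong (lab T) (transpose-other i j k≢i k≢j)) (sym (other₁ k k≢i)))
      T₂j : lab T₂ j ≡ lab T i
      T₂j = trans (other₂ j (≢-sym i≢j)) (cong (lab T) (transpose-snd i j))
      fresh : ¬ InTree T₁ (lab T₂ j)
      fresh (k , eq) with k ≟ i
      ... | yes refl = g∉ (i , trans (sym T₂j) (trans (sym eq) same₁))
      ... | no  k≢i  = k≢i (lab-inj T (trans (sym (other₁ k k≢i)) (trans eq T₂j)))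

  swap-labels : (T : LST ends) {i j : Fin (n ∸ 1)} → i ≢ j → SameBlock ends (lab T i) (lab T j) →
    ∃ λ k → k ≤ n + (3 + n) × Steps k T (relabel T (Perm.transpose i j))
  swap-labels T i≢j (inj₁ eq) = contradiction (lab-inj T eq) i≢j
  swap-labels T {i} {j} i≢j (inj₂ (C , e∈C , f∈C)) with Cycle⇒closed {Every} C (λ _ → tt)
  ... | x , w , ui , ue , on with third-edge w (lab T i) (lab T j) ue (on e∈C)
  ...   | g , g∈ , g≢e , g≢f with open-at w ui g∈
  ...     | a , b , jg , p , up , es↭ with absorb (es p) (path-Indep p up) (es p) id T
  ...       | T₀ , (k , k≤ , s) , has , keep =
    k + (3 + k) , +-mono-≤ k≤n (+-mono-≤ ≤-refl k≤n) ,
    -- By `keep`, labels `i` and `j` hold their edges during the absorption. Its reversal leads from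
    -- `T₀` to `T`, and relabelled it leads to the swapped `T`.
    Steps-trans s (Steps-trans
      (swap-on-path T₀ i≢j (swap jg) g∉ p up has (subst (_∈ es p) (sym (keep i e∈)) e∈) (subst (_∈ es p) (sym (keep j f∈)) f∈))
      (Steps-relabel (Perm.transpose i j) (Steps-sym s)))
    where
    k≤n : k ≤ n
    k≤n = ≤-trans k≤ (path-length p up)
    on-path : ∀ {h} → h ∈ es w → g ≢ h → h ∈ es p
    on-path h∈ g≢h with ∈-resp-↭ es↭ h∈
    ... | here h≡g = contradiction (sym h≡g) g≢h
    ... | there r  = r
    e∈ = on-path (on e∈C) g≢e
    f∈ = on-path (on f∈C) g≢f
    g∉ : ¬ InTree T₀ g
    g∉ g∈T₀ = indep T₀ g∈T₀ (swap jg)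
      (retype p λ h h∈ → has h∈ , λ { refl → Unique-head (Unique-↭ es↭ ue) h∈ })

  -- Selection sort, with `xs` the labels not yet settled: the label `j` now holding the edge wanted
  -- at `x` is swapped with `x`.
  sort : (T' : LST ends) (xs : List (Fin (n ∸ 1))) (T : LST ends) →
    (∀ i → SameBlock ends (lab T i) (lab T' i)) → (∀ i → InTree T (lab T' i)) →
    (∀ i → i ∈ xs ⊎ lab T i ≡ lab T' i) →
    ∃ λ k → k ≤ length xs * (n + (3 + n)) × Steps k T T'
  sort T' [] T sb has todo = 0 , z≤n , done (λ i → settled (todo i))
    where
    settled : ∀ {i} → i ∈ [] ⊎ lab T i ≡ lab T' i → lab T i ≡ lab T' i
    settled (inj₂ eq) = eq
  sort T' (x ∷ xs) T sb has todo with has x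
  ... | j , eqj with x ≟ j
  ... | yes refl with sort T' xs T sb has rest
    where
    rest : ∀ i → i ∈ xs ⊎ lab T i ≡ lab T' i
    rest i with todo i
    ... | inj₁ (here refl) = inj₂ eqj
    ... | inj₁ (there p)   = inj₁ p
    ... | inj₂ eq          = inj₂ eq
  ...   | k , k≤ , s = k , ≤-trans k≤ (m≤n+m _ _) , s
  sort T' (x ∷ xs) T sb has todo | j , eqj | no x≢j = finish (swap-labels T x≢j x~j) (sort T' xs S sb' (∈-relabel T π ∘ has) rest)
    where
    π = Perm.transpose x j
    S = relabel T π
    x~j : SameBlock ends (lab T x) (lab T j)
    x~j = subst (SameBlock ends (lab T x)) (sym eqj) (sb x)
    Sx : lab S x ≡ lab T' x
    Sx = trans (cong (lab T) (transpose-fst x j)) eqj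
    Sj : lab S j ≡ lab T x
    Sj = cong (lab T) (transpose-snd x j)
    S-other : ∀ {i} → i ≢ x → i ≢ j → lab S i ≡ lab T i
    S-other i≢x i≢j = cong (lab T) (transpose-other x j i≢x i≢j)
    sb' : ∀ i → SameBlock ends (lab S i) (lab T' i)
    sb' i = cases (i ≟ x) (i ≟ j)
      where
      cases : Dec (i ≡ x) → Dec (i ≡ j) → SameBlock ends (lab S i) (lab T' i)
      cases (yes refl) _          = inj₁ Sx
      cases (no _)     (yes refl) = subst (λ e → SameBlock ends e (lab T' j)) (sym Sj) (SameBlock-trans x~j (sb j))
      cases (no i≢x)   (no i≢j)   = subst (λ e → SameBlock ends e (lab T' i)) (sym (S-other i≢x i≢j)) (sb i)
    rest : ∀ i → i ∈ xs ⊎ lab S i ≡ lab T' i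
    rest i = cases (i ≟ x) (i ≟ j) (todo i)
      where
      cases : Dec (i ≡ x) → Dec (i ≡ j) → i ∈ x ∷ xs ⊎ lab T i ≡ lab T' i → i ∈ xs ⊎ lab S i ≡ lab T' i
      cases (yes refl) _          _                = inj₂ Sx
      cases (no i≢x)   _          (inj₁ (here eq)) = contradiction eq i≢x
      cases (no _)     _          (inj₁ (there p)) = inj₁ p
      -- The label `j` cannot be settled already, because it holds the edge that `T'` puts at `x`;
      -- hence no settled label is disturbed.
      cases (no _)     (yes refl) (inj₂ eq)        = contradiction (lab-inj T' (trans (sym eqj) eq)) x≢j
      cases (no i≢x)   (no i≢j)   (inj₂ eq)        = inj₂ (trans (S-other i≢x i≢j) eq)
    finish : _ → _ → _
    finish (k , k≤ , s) (l , l≤ , t) = k + l , +-mono-≤ k≤ l≤ , Steps-trans s t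

  reconfigure : (T T' : LST ends) → (∀ i → SameBlock ends (lab T i) (lab T' i)) →
    ∃ λ k → k ≤ 6 * (n * n) × Steps k T T'
  reconfigure T T' sb with absorb L indL L id T
    where
    L = tabulate (lab T')
    indL : Indep (_∈ L)
    indL = Indep-anti (λ e∈ → map₂ sym (∈-tabulate⁻ e∈)) (indep T')
  ... | T₁ , (k , k≤ , s) , has , _ with sort T' (allFin (n ∸ 1)) T₁
          -- The absorption itself moves labels only within blocks, so `T₁` inherits the block
          -- condition.
          (λ i → SameBlock-trans (SameBlock-sym (SameBlock-steps s i)) (sb i))
          (λ i → has (∈-tabulate⁺ i)) (λ i → inj₁ (∈-allFin i))
  ...   | l , l≤ , t = k + l , ≤-trans (+-mono-≤ (≤-trans k≤ (≤-reflexive (length-tabulate (lab T'))))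
            (≤-trans l≤ (≤-reflexive (cong (_* (n + (3 + n))) (length-tabulate {n = n ∸ 1} id)))))
            (bound n) , Steps-trans s t
    where
    bound : ∀ n → n ∸ 1 + (n ∸ 1) * (n + (3 + n)) ≤ 6 * (n * n)
    bound zero    = z≤n
    -- With `suc n` vertices the count is 2n² + 6n, and the added term is exactly what it lacks to
    -- 6(n + 1)².
    bound (suc n) = ≤-trans (m≤m+n _ (6 + 6 * n + 4 * (n * n))) (≤-reflexive (identity n))
      where
      identity : ∀ n → n + n * (suc n + (3 + suc n)) + (6 + 6 * n + 4 * (n * n)) ≡ 6 * (suc n * suc n)
      identity = solve-∀

theorem1 : Σ ℕ λ c →
    ∀ (n m : ℕ) (ends : Ends n m) → Simple ends →
    (T₁ T₂ : LST ends) →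
    ((Reconfigurable T₁ T₂ → ∀ i → SameBlock ends (lab T₁ i) (lab T₂ i)) ×
    ((∀ i → SameBlock ends (lab T₁ i) (lab T₂ i)) → Reconfigurable T₁ T₂)) ×
    (Reconfigurable T₁ T₂ → ∃ λ k → (k ≤ c * (n * n)) × Steps k T₁ T₂)
theorem1 = 6 , λ n m ends simple T₁ T₂ →
  ( (λ { (_ , s) → Trees.SameBlock-steps ends s })
  , λ sb → map₂ proj₂ (Sorting.reconfigure ends simple T₁ T₂ sb))
  -- The given sequence, of any length, yields the block condition, from which a short sequence is
  -- built afresh.
  , λ { (_ , s) → Sorting.reconfigure ends simple T₁ T₂ (Trees.SameBlock-steps ends s) }
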